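{- Let $\mathcal J$ be an ideal on $\omega$ which is a $P^+(\mathcal J)$-ideal and is $\le_{KB}$-homogeneous. (1) Assume CH. The following conditions are equivalent: (a) $\mathcal{ED}_{\mathrm{Fin}}\not\le_{KB}\mathcal J$; (b) there is a Q-point which is not a $\mathcal J$-point; (c) there is a Q-point which is not a weak $\mathcal J$-ultrafilter. (2) If $\mathcal J$ is $F_\sigma$, then CH can be relaxed to the assumption $\mathfrak p=\mathfrak c$ in (1).
   Context: An ideal on a set $X$ is a family of subsets of $X$ closed under finite unions and subsets, containing all finite subsets of $X$ and not containing $X$; $\mathcal J^+=\mathcal P(X)\setminus\mathcal J$. $F_\sigma$ refers to the topology of $\mathcal P(\omega)\cong\{0,1\}^\omega$. $\mathfrak c=2^{\aleph_0}$, and $\mathfrak p$ is the usual pseudointersection number. With $\Delta=\{(n,k)\in\omega^2:n\ge k\}$, $\mathcal{ED}_{\mathrm{Fin}}=\{A\subseteq\Delta:\exists m\ \forall n\ |\{k:(n,k)\in A\}|<m\}$, an ideal on $\Delta$. For ideals $\mathcal I$ on $X$ and $\mathcal K$ on $Y$, $\mathcal I\le_{KB}\mathcal K$ ($\mathcal I\le_P\mathcal K$) means that there is a finite-to-one (one-to-one, respectively) function $f:Y\to X$ with $f^{ -1}[B]\in\mathcal K$ for all $B\in\mathcal I$. $\mathcal J$ is a $P^+(\mathcal J)$-ideal if for each decreasing sequence $A_0\supseteq A_1\supseteq\dots$ of sets from $\mathcal J^+$ there is $B\in\mathcal J^+$ with $B\setminus A_n\in\mathcal J$ for all $n$. For $A\in\mathcal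 J^+$, $\mathcal J\restriction A=\{B\cap A:B\in\mathcal J\}$ (an ideal on $A$); $\mathcal J$ is $\le_{KB}$-homogeneous if $\mathcal J\restriction A\le_{KB}\mathcal J$ and $\mathcal J\le_{KB}\mathcal J\restriction A$ for every $A\in\mathcal J^+$. Ultrafilters on $\omega$ contain all cofinite sets; $\mathcal U^*=\{\omega\setminus A:A\in\mathcal U\}$. $\mathcal U$ is a weak $\mathcal J$-ultrafilter ($\mathcal J$-point) if $\mathcal J\not\le_{KB}\mathcal U^*$ ($\mathcal J\not\le_P\mathcal U^*$, respectively). $\mathcal U$ is a Q-point if for each partition $\{A_n:n\in\omega\}$ of $\omega$ into finite sets there is $A\in\mathcal U$ with $|A\cap A_n|=1$ for each $n$. -}

module Defs where

open import Level using (0ℓ)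
open import Data.Bool.Base using (Bool; true; T; _∧_; _∨_; not)
open import Data.List.Base using (List; length)
open import Data.List.Membership.Propositional using () renaming (_∈_ to _∈ₗ_)
open import Data.List.Relation.Unary.All using (All)
open import Data.Nat.Base using (ℕ; suc; _≤_; _<_)
open import Data.Product.Base using (Σ; Σ-syntax; ∃; ∃-syntax; _×_; _,_; proj₁)
open import Data.Product using (∃!)
open import Data.Sum.Base using (_⊎_)
open import Function.Base using (_∘_)
open import Function.Bundles using (_⇔_; _↣_; _⤖_)
open import Function.Definitions using (Injective)
open import Relation.Binary.PropositionalEquality.Core using (_≡_)
open import Relation.Nullary.Negation.Core using (¬_)
open import Relation.Unary using (Pred; _∈_; _⊆_; _⊇_; _≐_; ⋃) renaming (∁ to ∁ᵖ)

-- Subsets are points of {0,1}^X, so that 𝒫 ℕ is literally the Cantor space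
-- and membership is proof-irrelevant.  The theorem assumes excluded middle and
-- function extensionality; under these, every predicate on X is (equivalent
-- to) a unique element of 𝒫 X.

𝒫 : Set → Set
𝒫 X = X → Bool

⟪_⟫ : {X : Set} → 𝒫 X → Pred X 0ℓ
⟪ A ⟫ = T ∘ A

Elt : {X : Set} → 𝒫 X → Set
Elt {X} A = Σ X ⟪ A ⟫

full : {X : Set} → 𝒫 X
full _ = true

infixr 7 _∩_
infixr 6 _∪_ _∖_

_∩_ _∪_ _∖_ : {X : Set} → 𝒫 X → 𝒫 X → 𝒫 X
(A ∩ B) x = A x ∧ B x
(A ∪ B) x = A x ∨ B x
(A ∖ B) x = A x ∧ not (B x)

∁ : {X : Set} → 𝒫 X → 𝒫 X
∁ A x = not (A x)

_⁻¹[_] : {X Y : Set} → (Y → X) → 𝒫 X → 𝒫 Y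
f ⁻¹[ B ] = B ∘ f

∣_∣<_ : {X : Set} → Pred X 0ℓ → ℕ → Set
∣_∣<_ {X} P m = Σ[ xs ∈ List X ] length xs < m × (∀ {x} → x ∈ P → x ∈ₗ xs)

Finite Infinite : {X : Set} → Pred X 0ℓ → Set
Finite P = ∃[ m ] ∣ P ∣< m
Infinite P = ¬ Finite P

Family : Set → Set₁
Family X = Pred (𝒫 X) 0ℓ

record IsIdeal {X : Set} (J : Family X) : Set where
  field
    ⊆-closed : ∀ {A B} → ⟪ A ⟫ ⊆ ⟪ B ⟫ → B ∈ J → A ∈ J
    ∪-closed : ∀ {A B} → A ∈ J → B ∈ J → A ∪ B ∈ J
    finite∈  : ∀ {A} → Finite ⟪ A ⟫ → A ∈ J
    proper   : ¬ (full ∈ J)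

_⁺ : {X : Set} → Family X → Family X
J ⁺ = ∁ᵖ J

-- {B ∩ A : B ∈ J}, with B ∩ A viewed as a subset of the type Elt A.
_↾_ : {X : Set} → Family X → (A : 𝒫 X) → Family (Elt A)
(J ↾ A) C = ∃[ B ] B ∈ J × (∀ x → C x ≡ B (proj₁ x))

Δ : Set
Δ = Σ[ (n , k) ∈ ℕ × ℕ ] k ≤ n

ED-Fin : Family Δ
ED-Fin A = ∃[ m ] ∀ n → ∣ (λ k → Σ[ k≤n ∈ k ≤ n ] ((n , k) , k≤n) ∈ ⟪ A ⟫) ∣< m

FiniteToOne : {X Y : Set} → (Y → X) → Set
FiniteToOne f = ∀ x → Finite (λ y → f y ≡ x)

infix 4 _≤KB_ _≤P_

_≤KB_ : {X Y : Set} → Family X → Family Y → Set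
_≤KB_ {X} {Y} I K =
  Σ[ f ∈ (Y → X) ] FiniteToOne f × (∀ {B} → B ∈ I → f ⁻¹[ B ] ∈ K)

_≤P_ : {X Y : Set} → Family X → Family Y → Set
_≤P_ {X} {Y} I K =
  Σ[ f ∈ (Y → X) ] Injective _≡_ _≡_ f × (∀ {B} → B ∈ I → f ⁻¹[ B ] ∈ K)

P⁺-Ideal : {X : Set} → Family X → Set
P⁺-Ideal {X} J =
  (A : ℕ → 𝒫 X) → (∀ n → A n ∈ J ⁺) → (∀ n → ⟪ A n ⟫ ⊇ ⟪ A (suc n) ⟫) →
  ∃[ B ] B ∈ J ⁺ × (∀ n → B ∖ A n ∈ J)

KB-Homogeneous : {X : Set} → Family X → Set
KB-Homogeneous J = ∀ A → A ∈ J ⁺ → (J ↾ A ≤KB J) × (J ≤KB J ↾ A)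

record IsUltrafilter (U : Family ℕ) : Set where
  field
    ⊆-closed  : ∀ {A B} → ⟪ A ⟫ ⊆ ⟪ B ⟫ → A ∈ U → B ∈ U
    ∩-closed  : ∀ {A B} → A ∈ U → B ∈ U → A ∩ B ∈ U
    proper    : ∀ {A} → A ∈ U → ∃ ⟪ A ⟫
    ultra     : ∀ A → A ∈ U ⊎ ∁ A ∈ U
    cofinite∈ : ∀ {A} → Finite ⟪ ∁ A ⟫ → A ∈ U

_* : Family ℕ → Family ℕ
(U *) B = ∃[ A ] A ∈ U × (∀ x → B x ≡ ∁ A x)

IsWeakUltrafilter : Family ℕ → Family ℕ → Set
IsWeakUltrafilter J U = ¬ (J ≤KB U *)

IsPoint : Family ℕ → Family ℕ → Set
IsPoint J U = ¬ (J ≤P U *)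

record IsPartition (A : ℕ → 𝒫 ℕ) : Set where
  field
    nonempty : ∀ n → ∃ ⟪ A n ⟫
    covers   : ∀ x → ∃! _≡_ (λ n → x ∈ ⟪ A n ⟫)

record IsQPoint (U : Family ℕ) : Set where
  field
    isUltrafilter : IsUltrafilter U
    selector      : ∀ A → IsPartition A → (∀ n → Finite ⟪ A n ⟫) →
                    ∃[ S ] S ∈ U × (∀ n → ∃! _≡_ (λ x → x ∈ ⟪ S ∩ A n ⟫))

-- The product topology on {0,1}^ω: basic neighbourhoods of A fix A below n.

IsOpen IsClosed : Family ℕ → Set
IsOpen O = ∀ A → A ∈ O → ∃[ n ] ∀ B → (∀ k → k < n → B k ≡ A k) → B ∈ O
IsClosed C = IsOpen (∁ᵖ C)

IsFσ : Family ℕ → Set₁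
IsFσ F = Σ[ C ∈ (ℕ → Family ℕ) ] (∀ n → IsClosed (C n)) × F ≐ ⋃ ℕ C

-- |X| ≤ |Y| is X ↣ Y and |X| = |Y| is X ⤖ Y, and 𝔠 = |𝒫 ℕ|.

-- Every subset of 𝒫 ℕ is countable or has cardinality 𝔠 (as ≥ 𝔠; ≤ 𝔠 is automatic).

CH : Set
CH = (S : 𝒫 (𝒫 ℕ)) → (Elt S ↣ ℕ) ⊎ (𝒫 ℕ ↣ Elt S)

-- Every finite subfamily has infinite intersection.
HasSFIP : 𝒫 (𝒫 ℕ) → Set
HasSFIP F = ∀ As → All ⟪ F ⟫ As → Infinite (λ k → All (λ A → k ∈ ⟪ A ⟫) As)

HasPseudointersection : 𝒫 (𝒫 ℕ) → Set
HasPseudointersection F =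
  ∃[ B ] Infinite ⟪ B ⟫ × (∀ A → A ∈ ⟪ F ⟫ → Finite ⟪ B ∖ A ⟫)

-- |κ| is the least cardinality of a family with the SFIP and without a
-- pseudointersection.
IsPseudointersectionNumber : Set → Set
IsPseudointersectionNumber κ =
  (∃[ F ] Witness F × (Elt F ⤖ κ)) × (∀ F → Witness F → κ ↣ Elt F)
  where
  Witness : 𝒫 (𝒫 ℕ) → Set
  Witness F = HasSFIP F × ¬ HasPseudointersection F

𝔭≡𝔠 : Set
𝔭≡𝔠 = IsPseudointersectionNumber (𝒫 ℕ)

TFAE₃ : Set → Set₁ → Set₁ → Set₁
TFAE₃ a b c = (a ⇔ b) × (b ⇔ c)

-- For (a) ⇒ (b), build along a well-order of 𝒫 ℕ a ⊆-decreasing modulo J tower of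
-- J-positive sets that decides every subset of ℕ and selects from every partition into
-- finite sets.  The sets almost containing a member of the tower form a Q-point U with
-- U ∩ J = ∅, so the identity witnesses J ≤P U *.  A positive set B without a positive
-- partial selector for some partition would give ED-Fin ≤KB J ↾ B ≤KB J.  At limit
-- stages, CH leaves countably many sets and P⁺ yields a lower bound.  If J is the union of
-- closed sets C n and 𝔭 = 𝔠, a lower bound of the sets A i is the union of a
-- pseudointersection of the families of finite s ⊆ A i contained in no member of C n.
--
-- For (c) ⇒ (a), a Q-point contains a set on which a given finite-to-one map into Δ meets
-- every row at most once, so no finite-to-one map witnesses ED-Fin ≤KB U *.
module Submission where

open import Defs
open import Axiom.ExcludedMiddle using (ExcludedMiddle)
open import Axiom.Extensionality.Propositional using (Extensionality)
open import Data.Bool.Base using (Bool; true; false; T; not; if_then_else_)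
open import Data.Bool.Properties using (T-∧; T-∨; T-irrelevant; not-involutive)
open import Data.Empty using (⊥; ⊥-elim)
open import Data.List.Base using (List; []; _∷_; length; map; concatMap; upTo; drop)
open import Data.List.Membership.Propositional using (lose) renaming (_∈_ to _∈ₗ_)
open import Data.List.Membership.Propositional.Properties
  using (∈-map⁺; ∈-concatMap⁺; ∈-upTo⁺)
open import Data.List.Relation.Unary.All using (All; []; _∷_)
open import Data.List.Relation.Unary.Any using (here; there)
open import Data.Nat.Base using (ℕ; zero; suc; _≤_; _<_; _⊔_; z≤n; s≤s; z<s; s<s)
open import Data.Nat.Binary.Base using (ℕᵇ; zero; 2[1+_]; 1+[2_]; toℕ; fromℕ; size)
open import Data.Nat.Binary.Properties using (toℕ-fromℕ; fromℕ-toℕ)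
open import Data.Nat.Induction using (<-wellFounded)
open import Data.Nat.Properties
open import Data.Product.Base using (∃; ∃-syntax; Σ-syntax; _×_; _,_; proj₁; proj₂)
open import Data.Product using (∃!)
open import Data.Sum.Base using (_⊎_; inj₁; inj₂; [_,_]′)
open import Data.Unit.Base using (tt)
open import Function.Base using (_∘_; id; case_of_)
open import Function.Bundles using (_↣_; mk⇔; mk↣; module Equivalence; module Injection)
open import Function.Construct.Composition using (_↣-∘_)
open import Induction.WellFounded using (WellFounded; Acc; acc; WfRec; module All; module FixPoint)
open import Level using (0ℓ)
open import Relation.Binary.Core using (Rel)
open import Relation.Binary.Definitions using (tri<; tri≈; tri>)
open import Relation.Binary.PropositionalEquality
  using (_≡_; _≢_; refl; sym; trans; cong; cong₂; subst)
open import Relation.Nullary.Decidable.Core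
  using (Dec; yes; no; ⌊_⌋; toWitness; fromWitness; T?)
open import Relation.Nullary.Negation.Core using (¬_; contradiction)
open import Relation.Unary using (Pred; _∈_; _⊆_)

-- Booleans and membership in subsets.

¬T⇒T-not : ∀ b → ¬ T b → T (not b)
¬T⇒T-not false _  = tt
¬T⇒T-not true  ¬t = ¬t tt

T-not⇒¬T : ∀ b → T (not b) → ¬ T b
T-not⇒¬T false _ ()

T-injective : ∀ {a b} → (T a → T b) → (T b → T a) → a ≡ b
T-injective {false} {false} _ _ = refl
T-injective {false} {true}  _ g = ⊥-elim (g tt)
T-injective {true}  {false} f _ = ⊥-elim (f tt)
T-injective {true}  {true}  _ _ = refl

Elt-≡ : {X : Set} {A : 𝒫 X} {a b : Elt A} → proj₁ a ≡ proj₁ b → a ≡ b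
Elt-≡ {a = x , p} {b = _ , q} refl = cong (x ,_) (T-irrelevant p q)

module _ {X : Set} (A B : 𝒫 X) {x : X} where

  ∩⁺ : x ∈ ⟪ A ⟫ → x ∈ ⟪ B ⟫ → x ∈ ⟪ A ∩ B ⟫
  ∩⁺ a b = Equivalence.from T-∧ (a , b)

  ∩⁻ : x ∈ ⟪ A ∩ B ⟫ → x ∈ ⟪ A ⟫ × x ∈ ⟪ B ⟫
  ∩⁻ = Equivalence.to T-∧

  ∪⁺ : x ∈ ⟪ A ⟫ ⊎ x ∈ ⟪ B ⟫ → x ∈ ⟪ A ∪ B ⟫
  ∪⁺ = Equivalence.from T-∨

  ∖⁺ : x ∈ ⟪ A ⟫ → ¬ x ∈ ⟪ B ⟫ → x ∈ ⟪ A ∖ B ⟫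
  ∖⁺ a ¬b = Equivalence.from T-∧ (a , ¬T⇒T-not (B x) ¬b)

  ∖⁻ : x ∈ ⟪ A ∖ B ⟫ → x ∈ ⟪ A ⟫ × ¬ x ∈ ⟪ B ⟫
  ∖⁻ p = let a , b = Equivalence.to T-∧ p in a , T-not⇒¬T (B x) b

-- Finite sets and composition of finite-to-one reductions.

covered : {X : Set} {P : Pred X 0ℓ} (xs : List X) → (∀ {x} → x ∈ P → x ∈ₗ xs) → Finite P
covered xs c = suc (length xs) , xs , ≤-refl , c

Finite-⊆ : {X : Set} {P Q : Pred X 0ℓ} → P ⊆ Q → Finite Q → Finite P
Finite-⊆ P⊆Q (m , xs , l , c) = m , xs , l , c ∘ P⊆Q

Finite-∅ : {X : Set} {P : Pred X 0ℓ} → (∀ {x} → ¬ x ∈ P) → Finite P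
Finite-∅ ∅ = covered [] (⊥-elim ∘ ∅)

Finite-⋃ : {X Y : Set} {P : Pred X 0ℓ} {Q : X → Pred Y 0ℓ} →
           Finite P → (∀ x → Finite (Q x)) → Finite (λ y → ∃[ x ] x ∈ P × y ∈ Q x)
Finite-⋃ {X} {Y} (_ , xs , _ , c) fin =
  covered (concatMap ys xs)
    λ (x , p , q) → ∈-concatMap⁺ ys (lose (c p) (proj₂ (proj₂ (proj₂ (fin x))) q))
  where
  ys : X → List Y
  ys x = proj₁ (proj₂ (fin x))

list-bound : (xs : List ℕ) → ∃[ b ] ∀ {x} → x ∈ₗ xs → x ≤ b
list-bound []       = 0 , λ ()
list-bound (x ∷ xs) with list-bound xs
... | b , p = x ⊔ b , λ where
  (here refl) → m≤m⊔n x b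
  (there q)   → m≤n⇒m≤o⊔n x (p q)

Finite-< : ∀ n → Finite (_< n)
Finite-< n = covered (upTo n) ∈-upTo⁺

unbounded⇒Infinite : {X : Set} {P : Pred X 0ℓ} (f : X → ℕ) →
                     (∀ n → ∃[ x ] x ∈ P × n < f x) → Infinite P
unbounded⇒Infinite f unb (_ , xs , _ , c) with list-bound (map f xs)
... | b , p with unb b
...   | x , x∈P , b<fx = <⇒≱ b<fx (p (∈-map⁺ f (c x∈P)))

≤KB-trans : {X Y Z : Set} {I : Family X} {K : Family Y} {L : Family Z} →
            I ≤KB K → K ≤KB L → I ≤KB L
≤KB-trans (f , f-fin , f-pres) (g , g-fin , g-pres) =
  f ∘ g
  , (λ x → Finite-⊆ (λ e → _ , e , refl) (Finite-⋃ (f-fin x) g-fin))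
  , g-pres ∘ f-pres

-- Counting along a subset of ℕ.

count : 𝒫 ℕ → ℕ → ℕ
count M zero    = 0
count M (suc x) = if M x then suc (count M x) else count M x

module _ (M : 𝒫 ℕ) where

  count-mono : ∀ {x y} → x ≤ y → count M x ≤ count M y
  count-mono {y = zero}  z≤n = z≤n
  count-mono {x} {suc y} x≤  with m≤n⇒m<n∨m≡n x≤
  ... | inj₂ refl = ≤-refl
  ... | inj₁ (s≤s x≤y) with M y
  ...   | true  = m≤n⇒m≤1+n (count-mono x≤y)
  ...   | false = count-mono x≤y

  count-suc : ∀ {x} → x ∈ ⟪ M ⟫ → count M (suc x) ≡ suc (count M x)
  count-suc {x} x∈M with true ← M x = refl

  count-strict : ∀ {x y} → x ∈ ⟪ M ⟫ → x < y → count M x < count M y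
  count-strict x∈M x<y = subst (_≤ _) (count-suc x∈M) (count-mono x<y)

  count-injective : ∀ {x y} → x ∈ ⟪ M ⟫ → y ∈ ⟪ M ⟫ → count M x ≡ count M y → x ≡ y
  count-injective {x} {y} x∈M y∈M e with <-cmp x y
  ... | tri< x<y _ _ = contradiction e (<⇒≢ (count-strict x∈M x<y))
  ... | tri≈ _ x≡y _ = x≡y
  ... | tri> _ _ y<x = contradiction (sym e) (<⇒≢ (count-strict y∈M y<x))

  count-attains : ∀ x {n} → n < count M x → ∃[ y ] y ∈ ⟪ M ⟫ × count M y ≡ n
  count-attains (suc x) n< with T? (M x)
  ... | no x∉M  = count-attains x (subst (_ <_) (count-suc′ x∉M) n<)
    where
    count-suc′ : ¬ x ∈ ⟪ M ⟫ → count M (suc x) ≡ count M x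
    count-suc′ x∉M with M x
    ... | true  = ⊥-elim (x∉M tt)
    ... | false = refl
  ... | yes x∈M with m<1+n⇒m<n∨m≡n (subst (_ <_) (count-suc x∈M) n<)
  ...   | inj₁ n<c  = count-attains x n<c
  ...   | inj₂ refl = x , x∈M , refl

-- Finite subsets of ℕ are coded by bijective binary numerals.

mem : ℕᵇ → 𝒫 ℕ
mem zero     _       = false
mem 2[1+ b ] zero    = true
mem 2[1+ b ] (suc x) = mem b x
mem 1+[2 b ] zero    = false
mem 1+[2 b ] (suc x) = mem b x

-- The code always has exactly `k` digits, so truncations of different lengths have different codes
-- even when they are equal as sets.
trunc : 𝒫 ℕ → ℕ → ℕᵇ
trunc A zero    = zero
trunc A (suc k) = if A 0 then 2[1+ trunc (A ∘ suc) k ] else 1+[2 trunc (A ∘ suc) k ]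

mem<size : ∀ b {x} → x ∈ ⟪ mem b ⟫ → x < size b
mem<size 2[1+ b ] {zero}  _ = z<s
mem<size 2[1+ b ] {suc x} p = s<s (mem<size b p)
mem<size 1+[2 b ] {suc x} p = s<s (mem<size b p)

Finite-mem : ∀ b → Finite ⟪ mem b ⟫
Finite-mem b = Finite-⊆ (mem<size b) (Finite-< (size b))

size-trunc : ∀ A k → size (trunc A k) ≡ k
size-trunc A zero    = refl
size-trunc A (suc k) with A 0
... | true  = cong suc (size-trunc (A ∘ suc) k)
... | false = cong suc (size-trunc (A ∘ suc) k)

mem-trunc⁻ : ∀ A k {x} → x ∈ ⟪ mem (trunc A k) ⟫ → x ∈ ⟪ A ⟫
mem-trunc⁻ A (suc k) {x} p with A 0 in eq
mem-trunc⁻ A (suc k) {zero}  p | true  = subst T (sym eq) tt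
mem-trunc⁻ A (suc k) {suc x} p | true  = mem-trunc⁻ (A ∘ suc) k p
mem-trunc⁻ A (suc k) {suc x} p | false = mem-trunc⁻ (A ∘ suc) k p

mem-trunc⁺ : ∀ A {k x} → x < k → x ∈ ⟪ A ⟫ → x ∈ ⟪ mem (trunc A k) ⟫
mem-trunc⁺ A {suc k} {x} x<k p with A 0 in eq
mem-trunc⁺ A {suc k} {zero}  x<k       p | true  = tt
mem-trunc⁺ A {suc k} {zero}  x<k       p | false = subst T eq p
mem-trunc⁺ A {suc k} {suc x} (s≤s x<k) p | true  = mem-trunc⁺ (A ∘ suc) x<k p
mem-trunc⁺ A {suc k} {suc x} (s≤s x<k) p | false = mem-trunc⁺ (A ∘ suc) x<k p

-- Coding a sequence of subsets by one subset.

pair : ℕ → ℕ → ℕᵇ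
-- The numeral has `a` digits 2, then one digit 1 as a separator, then the numeral of `b`.
pair zero    b = 1+[2 fromℕ b ]
pair (suc a) b = 2[1+ pair a b ]

unpair : ℕᵇ → ℕ × ℕ
unpair zero     = 0 , 0
unpair 1+[2 x ] = 0 , toℕ x
unpair 2[1+ x ] = let a , b = unpair x in suc a , b

unpair-pair : ∀ a b → unpair (pair a b) ≡ (a , b)
unpair-pair zero    b = cong (0 ,_) (toℕ-fromℕ b)
unpair-pair (suc a) b = cong (λ (a , b) → suc a , b) (unpair-pair a b)

rows : 𝒫 ℕ → ℕ → 𝒫 ℕ
rows X a b = X (toℕ (pair a b))

unrows : (ℕ → 𝒫 ℕ) → 𝒫 ℕ
unrows S k = let a , b = unpair (fromℕ k) in S a b

rows-unrows : ∀ S a b → rows (unrows S) a b ≡ S a b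
rows-unrows S a b = cong (λ (a , b) → S a b)
  (trans (cong unpair (fromℕ-toℕ (pair a b))) (unpair-pair a b))

-- Finite intersections and inclusion modulo an ideal.

⋂ˡ : {X I : Set} → (I → 𝒫 X) → List I → 𝒫 X
⋂ˡ A []       = full
⋂ˡ A (i ∷ is) = A i ∩ ⋂ˡ A is

module Ideal {J : Family ℕ} (isIdeal : IsIdeal J) where
  open IsIdeal isIdeal

  ∈J-cover : ∀ {A B D} → A ∈ J → B ∈ J → (∀ {x} → x ∈ ⟪ D ⟫ → x ∈ ⟪ A ⟫ ⊎ x ∈ ⟪ B ⟫) → D ∈ J
  ∈J-cover {A} {B} a b c = ⊆-closed (∪⁺ A B ∘ c) (∪-closed a b)

  ∅∈J : ∀ {D} → (∀ {x} → ¬ x ∈ ⟪ D ⟫) → D ∈ J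
  ∅∈J ∅ = finite∈ (Finite-∅ ∅)

  infix 4 _⊆ᴶ_

  _⊆ᴶ_ : 𝒫 ℕ → 𝒫 ℕ → Set
  A ⊆ᴶ B = A ∖ B ∈ J

  ⊆⇒⊆ᴶ : ∀ A B → ⟪ A ⟫ ⊆ ⟪ B ⟫ → A ⊆ᴶ B
  ⊆⇒⊆ᴶ A B A⊆B = ∅∈J (λ p → let a , ¬b = ∖⁻ A B p in ¬b (A⊆B a))

  ⊆ᴶ-refl : ∀ A → A ⊆ᴶ A
  ⊆ᴶ-refl A = ⊆⇒⊆ᴶ A A id

  ⊆ᴶ-trans : ∀ A B C → A ⊆ᴶ B → B ⊆ᴶ C → A ⊆ᴶ C
  ⊆ᴶ-trans A B C p q = ∈J-cover p q λ {x} r →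
    let a , ¬c = ∖⁻ A C r in
    case T? (B x) of λ where
      (yes b) → inj₂ (∖⁺ B C b ¬c)
      (no ¬b) → inj₁ (∖⁺ A B a ¬b)

  ⊆ᴶ-∩ : ∀ A B C → A ⊆ᴶ B → A ⊆ᴶ C → A ⊆ᴶ B ∩ C
  ⊆ᴶ-∩ A B C p q = ∈J-cover p q λ {x} r →
    let a , ¬bc = ∖⁻ A (B ∩ C) r in
    case T? (B x) of λ where
      (yes b) → inj₂ (∖⁺ A C a (¬bc ∘ ∩⁺ B C b))
      (no ¬b) → inj₁ (∖⁺ A B a ¬b)

  J⁺-⊆ᴶ : ∀ A B → A ⊆ᴶ B → A ∈ J ⁺ → B ∈ J ⁺
  J⁺-⊆ᴶ A B p a b = a (∈J-cover p b λ {x} x∈A →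
    case T? (B x) of λ where
      (yes x∈B) → inj₂ x∈B
      (no x∉B)  → inj₁ (∖⁺ A B x∈A x∉B))

  Centred : {I : Set} → (I → 𝒫 ℕ) → Set
  Centred A = ∀ is → ⋂ˡ A is ∈ J ⁺

  -- This isolates what the tower needs at limit stages; CH and 𝔭 = 𝔠 enter the construction only
  -- through it.
  HasLimits : Set → Set
  HasLimits I = (A : I → 𝒫 ℕ) → Centred A → ∃[ B ] B ∈ J ⁺ × (∀ i → B ⊆ᴶ A i)

-- Classical principles and a well-order of an arbitrary set.

module Classical (em : ExcludedMiddle 0ℓ) (ext : Extensionality 0ℓ 0ℓ) where

  dec : {P : Set} → Dec P
  dec = em

  ⌈_⌉ : Set → Bool
  ⌈ P ⌉ = ⌊ dec {P} ⌋

  ⌈⌉⁺ : {P : Set} → P → T ⌈ P ⌉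
  ⌈⌉⁺ = fromWitness

  ⌈⌉⁻ : {P : Set} → T ⌈ P ⌉ → P
  ⌈⌉⁻ = toWitness

  stable : {P : Set} → ¬ ¬ P → P
  stable ¬¬p with dec
  ... | yes p = p
  ... | no ¬p = ⊥-elim (¬¬p ¬p)

  ¬∀⇒∃¬ : {X : Set} {P : Pred X 0ℓ} → ¬ (∀ x → P x) → ∃[ x ] ¬ P x
  ¬∀⇒∃¬ ¬∀ = stable λ ¬∃ → ¬∀ λ x → stable λ ¬p → ¬∃ (x , ¬p)

  𝒫-ext : {X : Set} {A B : 𝒫 X} → ⟪ A ⟫ ⊆ ⟪ B ⟫ → ⟪ B ⟫ ⊆ ⟪ A ⟫ → A ≡ B
  𝒫-ext p q = ext λ _ → T-injective p q

  least : {X : Set} {_≺_ : Rel X 0ℓ} → WellFounded _≺_ → {P : Pred X 0ℓ} →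
          ∃ P → ∃[ x ] P x × (∀ y → y ≺ x → ¬ P y)
  least {X} {_≺_} wf {P} (x , p) = All.wfRec wf 0ℓ (λ x → P x → Least) step x p
    where
    Least : Set
    Least = ∃[ x ] P x × (∀ y → y ≺ x → ¬ P y)
    step : ∀ x → WfRec _≺_ (λ x → P x → Least) x → P x → Least
    step x ih p with dec {∃[ y ] y ≺ x × P y}
    ... | yes (y , y≺x , q) = ih y≺x q
    ... | no ¬∃             = x , p , λ y y≺x q → ¬∃ (y , y≺x , q)

  -- Zermelo's theorem: the sets generated from S ↦ S ∪ {pick S} and unions form a chain,
  -- and x precedes y when x belongs to the largest of them avoiding y.
  module WellOrder {X : Set} (x₀ : X) where

    pick : 𝒫 X → X
    pick S with dec {∃[ x ] ¬ x ∈ ⟪ S ⟫}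
    ... | yes (x , _) = x
    ... | no _        = x₀

    pick-∉ : ∀ S {x} → ¬ x ∈ ⟪ S ⟫ → ¬ pick S ∈ ⟪ S ⟫
    pick-∉ S {x} x∉S with dec {∃[ x ] ¬ x ∈ ⟪ S ⟫}
    ... | yes (_ , y∉S) = y∉S
    ... | no ¬∃         = ⊥-elim (¬∃ (x , x∉S))

    succ : 𝒫 X → 𝒫 X
    succ S x = ⌈ x ∈ ⟪ S ⟫ ⊎ x ≡ pick S ⌉

    ⊆-succ : ∀ S → ⟪ S ⟫ ⊆ ⟪ succ S ⟫
    ⊆-succ S x∈S = ⌈⌉⁺ (inj₁ x∈S)

    ⋃ᵇ : 𝒫 (𝒫 X) → 𝒫 X
    ⋃ᵇ 𝓕 x = ⌈ ∃[ S ] S ∈ ⟪ 𝓕 ⟫ × x ∈ ⟪ S ⟫ ⌉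

    data Stage : 𝒫 X → Set where
      next  : ∀ {S} → Stage S → Stage (succ S)
      union : (𝓕 : 𝒫 (𝒫 X)) → (∀ {S} → S ∈ ⟪ 𝓕 ⟫ → Stage S) → Stage (⋃ᵇ 𝓕)

    -- These are the extreme points of the Bourbaki-Witt argument. Once every stage is known to be
    -- extreme, the stages form a chain.
    Extreme : 𝒫 X → Set
    Extreme R = ∀ {S} → Stage S → ⟪ S ⟫ ⊆ ⟪ R ⟫ → S ≡ R ⊎ ⟪ succ S ⟫ ⊆ ⟪ R ⟫

    extreme-compare : ∀ {R S} → Extreme R → Stage S → ⟪ S ⟫ ⊆ ⟪ R ⟫ ⊎ ⟪ succ R ⟫ ⊆ ⟪ S ⟫
    extreme-compare {R} ex (next {S} t) with extreme-compare ex t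
    ... | inj₂ p = inj₂ (⊆-succ S ∘ p)
    ... | inj₁ p with ex t p
    ...   | inj₁ refl = inj₂ id
    ...   | inj₂ q    = inj₁ q
    extreme-compare {R} ex (union 𝓕 h) with dec {∃[ S ] S ∈ ⟪ 𝓕 ⟫ × ⟪ succ R ⟫ ⊆ ⟪ S ⟫}
    ... | yes (S , m , p) = inj₂ λ x∈ → ⌈⌉⁺ (S , m , p x∈)
    ... | no ¬∃           = inj₁ λ x∈ →
      let S , m , x∈S = ⌈⌉⁻ x∈ in
      case extreme-compare ex (h m) of λ where
        (inj₁ S⊆R) → S⊆R x∈S
        (inj₂ p)   → ⊥-elim (¬∃ (S , m , λ {_} → p))

    extreme : ∀ {R} → Stage R → Extreme R
    extreme (next {R} t) {S} tS S⊆ with extreme-compare (extreme t) tS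
    ... | inj₂ p = inj₁ (𝒫-ext S⊆ p)
    ... | inj₁ p with extreme t tS p
    ...   | inj₁ refl = inj₂ id
    ...   | inj₂ q    = inj₂ (⊆-succ R ∘ q)
    extreme (union 𝓕 h) {S} tS S⊆ with dec {∃[ R ] R ∈ ⟪ 𝓕 ⟫ × ⟪ S ⟫ ⊆ ⟪ R ⟫ × S ≢ R}
    -- No member of `𝓕` contains `S` properly, so by comparison each member lies inside `S`.
    ... | no ¬∃ = inj₁ (𝒫-ext S⊆ λ x∈ →
      let R , m , x∈R = ⌈⌉⁻ x∈ in
      case extreme-compare (extreme (h m)) tS of λ where
        (inj₁ S⊆R) → subst (λ R → _ ∈ ⟪ R ⟫)
                       (sym (stable λ S≢R → ¬∃ (R , m , (λ {_} → S⊆R) , S≢R))) x∈R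
        (inj₂ q)   → q (⊆-succ R x∈R))
    ... | yes (R , m , S⊆R , S≢R) with extreme (h m) tS S⊆R
    ...   | inj₁ S≡R = contradiction S≡R S≢R
    ...   | inj₂ q   = inj₂ λ x∈ → ⌈⌉⁺ (R , m , q x∈)

    compare : ∀ {R S} → Stage R → Stage S → ⟪ S ⟫ ⊆ ⟪ R ⟫ ⊎ ⟪ succ R ⟫ ⊆ ⟪ S ⟫
    compare = extreme-compare ∘ extreme

    seg : X → 𝒫 X
    seg x = ⋃ᵇ λ S → ⌈ Stage S × ¬ x ∈ ⟪ S ⟫ ⌉

    seg-stage : ∀ x → Stage (seg x)
    seg-stage x = union _ (proj₁ ∘ ⌈⌉⁻)

    seg-irrefl : ∀ x → ¬ x ∈ ⟪ seg x ⟫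
    seg-irrefl x p = let S , q , x∈S = ⌈⌉⁻ p in proj₂ (⌈⌉⁻ q) x∈S

    -- Otherwise `succ (seg x)` would be a stage avoiding `x`, hence part of `seg x`, although
    -- `pick (seg x)` lies outside `seg x`.
    ∈-succ-seg : ∀ x → x ∈ ⟪ succ (seg x) ⟫
    ∈-succ-seg x = stable λ ∉ →
      pick-∉ (seg x) (seg-irrefl x)
        (⌈⌉⁺ (succ (seg x) , ⌈⌉⁺ (next (seg-stage x) , ∉) , ⌈⌉⁺ (inj₂ refl)))

    pick-seg : ∀ x → x ≡ pick (seg x)
    pick-seg x with ⌈⌉⁻ (∈-succ-seg x)
    ... | inj₁ x∈  = contradiction x∈ (seg-irrefl x)
    ... | inj₂ x≡ = x≡

    infix 4 _≺_

    _≺_ : Rel X 0ℓ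
    x ≺ y = x ∈ ⟪ seg y ⟫

    ≺-cmp : ∀ x y → x ≺ y ⊎ x ≡ y ⊎ y ≺ x
    ≺-cmp x y with compare (seg-stage x) (seg-stage y) | compare (seg-stage y) (seg-stage x)
    ... | inj₂ p | _      = inj₁ (p (∈-succ-seg x))
    ... | inj₁ _ | inj₂ q = inj₂ (inj₂ (q (∈-succ-seg y)))
    ... | inj₁ p | inj₁ q = inj₂ (inj₁
      (trans (pick-seg x) (trans (cong pick (𝒫-ext q p)) (sym (pick-seg y)))))

    ≺⇒seg⊆seg : ∀ {x y} → x ≺ y → ⟪ seg x ⟫ ⊆ ⟪ seg y ⟫
    ≺⇒seg⊆seg {x} {y} x≺y with compare (seg-stage y) (seg-stage x)
    ... | inj₁ p = p
    ... | inj₂ q = ⊥-elim (seg-irrefl x (q (⊆-succ (seg y) x≺y)))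

    -- Induction on stages: if `x` is new in `succ S`, then `seg x` lies inside `S`, since otherwise
    -- `seg x` would contain `succ S` and with it `x`.
    stage-accessible : ∀ {S x} → Stage S → x ∈ ⟪ S ⟫ → Acc _≺_ x
    stage-accessible {x = x} (next {S} t) x∈ with T? (S x)
    ... | yes x∈S = stage-accessible t x∈S
    ... | no x∉S with compare t (seg-stage x)
    ...   | inj₁ p = acc (stage-accessible t ∘ p)
    ...   | inj₂ q = ⊥-elim (seg-irrefl x (q x∈))
    stage-accessible (union 𝓕 h) p = let S , m , x∈S = ⌈⌉⁻ p in stage-accessible (h m) x∈S

    ≺-wellFounded : WellFounded _≺_
    ≺-wellFounded x = stage-accessible (next (seg-stage x)) (∈-succ-seg x)

  -- Infinite subsets of ℕ and fibres of finite-to-one maps.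

  unique⇒∣∣<2 : {X : Set} {P : Pred X 0ℓ} → (∀ {x y} → P x → P y → x ≡ y) → ∣ P ∣< 2
  unique⇒∣∣<2 {P = P} unique with dec {∃ P}
  ... | yes (x , p) = x ∷ [] , ≤-refl , λ q → here (unique q p)
  ... | no ¬∃       = [] , s≤s z≤n , λ p → ⊥-elim (¬∃ (_ , p))

  injective⇒FiniteToOne : {X Y : Set} {f : Y → X} →
                          (∀ {y z} → f y ≡ f z → y ≡ z) → FiniteToOne f
  injective⇒FiniteToOne inj x = 2 , unique⇒∣∣<2 λ p q → inj (trans p (sym q))

  module _ {M : 𝒫 ℕ} (inf : Infinite ⟪ M ⟫) where

    Infinite⇒cofinal : ∀ n → ∃[ y ] y ∈ ⟪ M ⟫ × n ≤ y
    Infinite⇒cofinal n = stable λ ¬∃ →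
      inf (Finite-⊆ (λ y∈M → ≰⇒> λ n≤y → ¬∃ (_ , y∈M , n≤y)) (Finite-< n))

    count-unbounded : ∀ n → ∃[ x ] n ≤ count M x
    count-unbounded zero    = 0 , z≤n
    count-unbounded (suc n) with count-unbounded n
    ... | x , n≤c with Infinite⇒cofinal x
    ...   | y , y∈M , x≤y =
      suc y , subst (suc n ≤_) (sym (count-suc M y∈M)) (s≤s (≤-trans n≤c (count-mono M x≤y)))

    count-surjective : ∀ n → ∃[ y ] y ∈ ⟪ M ⟫ × count M y ≡ n
    count-surjective n = let x , n< = count-unbounded (suc n) in count-attains M x n<

  module LeastRepresentatives (h : ℕ → ℕ) where

    rep : ∀ x → ∃[ r ] h r ≡ h x × (∀ y → y < r → h y ≢ h x)
    rep x = least <-wellFounded (x , refl)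

    repr : ℕ → ℕ
    repr = proj₁ ∘ rep

    h-repr : ∀ x → h (repr x) ≡ h x
    h-repr = proj₁ ∘ proj₂ ∘ rep

    IsRep : 𝒫 ℕ
    IsRep x = ⌈ (∀ y → y < x → h y ≢ h x) ⌉

    repr-IsRep : ∀ x → repr x ∈ ⟪ IsRep ⟫
    repr-IsRep x = ⌈⌉⁺ λ y y<r hy≡hr → proj₂ (proj₂ (rep x)) y y<r (trans hy≡hr (h-repr x))

    IsRep-unique : ∀ {x y} → x ∈ ⟪ IsRep ⟫ → y ∈ ⟪ IsRep ⟫ → h x ≡ h y → x ≡ y
    IsRep-unique {x} {y} p q e with <-cmp x y
    ... | tri< x<y _ _ = contradiction e (⌈⌉⁻ q x x<y)
    ... | tri≈ _ x≡y _ = x≡y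
    ... | tri> _ _ y<x = contradiction (sym e) (⌈⌉⁻ p y y<x)

    module _ (fin : FiniteToOne h) where

      -- With finitely many representatives, ℕ would be a finite union of finite fibres.
      IsRep-infinite : Infinite ⟪ IsRep ⟫
      IsRep-infinite M-fin =
        unbounded⇒Infinite {P = ⟪ full ⟫} id (λ n → suc n , tt , ≤-refl)
          (Finite-⊆ (λ {x} _ → repr x , repr-IsRep x , sym (h-repr x))
            (Finite-⋃ M-fin (fin ∘ h)))

      -- A partition needs a non-empty block at every index. Counting least representatives numbers
      -- the non-empty fibres of `h` without gaps.
      fibreIndex : ℕ → ℕ
      fibreIndex x = count IsRep (repr x)

      fibreIndex-injective : ∀ {x y} → fibreIndex x ≡ fibreIndex y → h x ≡ h y
      fibreIndex-injective {x} {y} e =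
        trans (sym (h-repr x))
          (trans (cong h (count-injective IsRep (repr-IsRep x) (repr-IsRep y) e)) (h-repr y))

      fibreIndex-cong : ∀ {x y} → h x ≡ h y → fibreIndex x ≡ fibreIndex y
      fibreIndex-cong {x} {y} e =
        cong (count IsRep) (IsRep-unique (repr-IsRep x) (repr-IsRep y)
          (trans (h-repr x) (trans e (sym (h-repr y)))))

      fibreIndex-surjective : ∀ n → ∃[ x ] fibreIndex x ≡ n
      fibreIndex-surjective n =
        let y , y∈M , e = count-surjective IsRep-infinite n in
        y , trans (cong (count IsRep) (IsRep-unique (repr-IsRep y) y∈M (h-repr y))) e

      fibre : ℕ → 𝒫 ℕ
      fibre n x = ⌈ fibreIndex x ≡ n ⌉

      fibre-partition : IsPartition fibre
      fibre-partition = record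
        { nonempty = λ n → let x , e = fibreIndex-surjective n in x , ⌈⌉⁺ e
        ; covers   = λ x → fibreIndex x , ⌈⌉⁺ refl , ⌈⌉⁻
        }

      fibre-finite : ∀ n → Finite ⟪ fibre n ⟫
      fibre-finite n =
        let x , e = fibreIndex-surjective n in
        Finite-⊆ (λ p → fibreIndex-injective (trans (⌈⌉⁻ p) (sym e))) (fin (h x))

  -- Q-points and the ideal `ED-Fin`.

  abstract
    QPoint-injective : ∀ {U} → IsQPoint U → {h : ℕ → ℕ} → FiniteToOne h →
      ∃[ S ] S ∈ U × (∀ {x y} → x ∈ ⟪ S ⟫ → y ∈ ⟪ S ⟫ → h x ≡ h y → x ≡ y)
    QPoint-injective {U} q {h} fin =
      let S , S∈U , one =
            IsQPoint.selector q (fibre fin) (fibre-partition fin) (fibre-finite fin) in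
      S , S∈U , injective S one
      where
      open LeastRepresentatives h
      injective : ∀ S → (∀ n → ∃! _≡_ (λ x → x ∈ ⟪ S ∩ fibre fin n ⟫)) →
                  ∀ {x y} → x ∈ ⟪ S ⟫ → y ∈ ⟪ S ⟫ → h x ≡ h y → x ≡ y
      injective S one {x} x∈S y∈S hx≡hy =
        let _ , _ , unique = one (fibreIndex fin x) in
        trans (sym (unique (∩⁺ S (fibre fin _) x∈S (⌈⌉⁺ refl))))
              (unique (∩⁺ S (fibre fin _) y∈S (⌈⌉⁺ (fibreIndex-cong fin (sym hx≡hy)))))

  Δ-row-finite : ∀ n → Finite (λ (d : Δ) → proj₁ (proj₁ d) ≡ n)
  Δ-row-finite n =
    Finite-⊆ {Q = λ d → ∃[ k ] k < suc n × proj₁ d ≡ (n , k)} (λ {d} → in-row d)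
      (Finite-⋃ (Finite-< (suc n)) λ k → injective⇒FiniteToOne Δ-≡ (n , k))
    where
    Δ-≡ : ∀ {d e : Δ} → proj₁ d ≡ proj₁ e → d ≡ e
    Δ-≡ {_ , p} {_ , q} refl = cong (_ ,_) (≤-irrelevant p q)
    in-row : ∀ (d : Δ) → proj₁ (proj₁ d) ≡ n → ∃[ k ] k < suc n × proj₁ d ≡ (n , k)
    in-row ((_ , k) , k≤n) refl = k , s≤s k≤n , refl

  -- Rows of Δ are finite, so `row` is finite-to-one and injective on some `S ∈ U`. The image of `S`
  -- is then in `ED-Fin`; its preimage contains `S` but is the complement of some `A ∈ U`, so
  -- `S ∩ A` would be empty.
  QPoint⇒ED-Fin≰KB : ∀ {U} → IsQPoint U → ¬ (ED-Fin ≤KB U *)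
  QPoint⇒ED-Fin≰KB {U} q (f , f-fin , f-pres) =
    let S , S∈U , inj = QPoint-injective {U} q {row} row-fin
        A , A∈U , e = f-pres {image S} (image∈ED S inj)
        x , x∈ = proper (∩-closed S∈U A∈U)
        x∈S , x∈A = ∩⁻ S A x∈
    in T-not⇒¬T (A x) (subst T (e x) (⌈⌉⁺ (x , x∈S , refl))) x∈A
    where
    open IsUltrafilter (IsQPoint.isUltrafilter q)
    row : ℕ → ℕ
    row = proj₁ ∘ proj₁ ∘ f
    row-fin : FiniteToOne row
    row-fin n = Finite-⊆ (λ e → _ , e , refl) (Finite-⋃ (Δ-row-finite n) f-fin)
    image : 𝒫 ℕ → 𝒫 Δ
    image S d = ⌈ ∃[ x ] x ∈ ⟪ S ⟫ × f x ≡ d ⌉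
    image∈ED : ∀ S → (∀ {x y} → x ∈ ⟪ S ⟫ → y ∈ ⟪ S ⟫ → row x ≡ row y → x ≡ y) → image S ∈ ED-Fin
    -- The bound is strict, so `2` means at most one point in each row.
    image∈ED S inj = 2 , λ n → unique⇒∣∣<2 unique
      where
      InRow : ℕ → ℕ → Set
      InRow n k = Σ[ k≤n ∈ k ≤ n ] ((n , k) , k≤n) ∈ ⟪ image S ⟫
      unique : ∀ {n k l} → InRow n k → InRow n l → k ≡ l
      unique (_ , p) (_ , p′) with ⌈⌉⁻ p | ⌈⌉⁻ p′
      ... | x , x∈S , ex | y , y∈S , ey =
        trans (sym (cong (proj₂ ∘ proj₁) ex))
          (trans (cong (proj₂ ∘ proj₁ ∘ f) (inj x∈S y∈S
                   (trans (cong (proj₁ ∘ proj₁) ex) (sym (cong (proj₁ ∘ proj₁) ey)))))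
            (cong (proj₂ ∘ proj₁) ey))

  -- Partial selectors and `ED-Fin` on positive sets.

  PartialSelector : (ℕ → 𝒫 ℕ) → 𝒫 ℕ → Set
  PartialSelector P S =
    ∀ n {x y} → x ∈ ⟪ S ⟫ → y ∈ ⟪ S ⟫ → x ∈ ⟪ P n ⟫ → y ∈ ⟪ P n ⟫ → x ≡ y

  module _ {J : Family ℕ} (isIdeal : IsIdeal J) {P : ℕ → 𝒫 ℕ} (partition : IsPartition P)
           {B : 𝒫 ℕ} (selectors∈J : ∀ {S} → ⟪ S ⟫ ⊆ ⟪ B ⟫ → PartialSelector P S → S ∈ J) where

    open Ideal isIdeal

    class : ℕ → ℕ
    class x = proj₁ (IsPartition.covers partition x)

    ∈-class : ∀ x → x ∈ ⟪ P (class x) ⟫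
    ∈-class x = proj₁ (proj₂ (IsPartition.covers partition x))

    class-unique : ∀ {n x} → x ∈ ⟪ P n ⟫ → class x ≡ n
    class-unique {x = x} = proj₂ (proj₂ (IsPartition.covers partition x))

    -- Induction on `m`: the points of `D` that head the list of their block form a partial
    -- selector, and the others are listed in the tails, whose length is at most one less than the
    -- bound.
    listed∈J : ∀ m (xs : ℕ → List ℕ) → (∀ n → length (xs n) ≤ m) → ∀ {D} →
               ⟪ D ⟫ ⊆ ⟪ B ⟫ → (∀ {x} → x ∈ ⟪ D ⟫ → x ∈ₗ xs (class x)) → D ∈ J
    listed∈J zero xs bound D⊆B listed = ∅∈J λ {x} x∈D → no-elements (bound (class x)) (listed x∈D)
      where
      no-elements : ∀ {ys : List ℕ} {y} → length ys ≤ 0 → ¬ y ∈ₗ ys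
      no-elements {[]} _ ()
    listed∈J (suc m) xs bound {D} D⊆B listed =
      ∈J-cover {D₀} {D₁}
        (selectors∈J (D⊆B ∘ proj₁ ∘ ⌈⌉⁻) D₀-selector)
        (listed∈J m (drop 1 ∘ xs) (λ n → drop-bound (xs n) (bound n))
          (D⊆B ∘ proj₁ ∘ ⌈⌉⁻) (proj₂ ∘ ⌈⌉⁻))
        λ {x} x∈D → case split (listed x∈D) of λ where
          (inj₁ hd) → inj₁ (⌈⌉⁺ (x∈D , hd))
          (inj₂ tl) → inj₂ (⌈⌉⁺ (x∈D , tl))
      where
      Head : ℕ → List ℕ → Set
      Head x ys = ∃[ zs ] ys ≡ x ∷ zs
      D₀ D₁ : 𝒫 ℕ
      D₀ x = ⌈ x ∈ ⟪ D ⟫ × Head x (xs (class x)) ⌉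
      D₁ x = ⌈ x ∈ ⟪ D ⟫ × x ∈ₗ drop 1 (xs (class x)) ⌉
      split : ∀ {x ys} → x ∈ₗ ys → Head x ys ⊎ x ∈ₗ drop 1 ys
      split (here refl) = inj₁ (_ , refl)
      split (there p)   = inj₂ p
      drop-bound : ∀ (ys : List ℕ) → length ys ≤ suc m → length (drop 1 ys) ≤ m
      drop-bound []       _       = z≤n
      drop-bound (_ ∷ ys) (s≤s l) = l
      head-unique : ∀ {x y ys} → Head x ys → Head y ys → x ≡ y
      head-unique (_ , refl) (_ , refl) = refl
      D₀-selector : PartialSelector P D₀
      D₀-selector n p q x∈P y∈P =
        head-unique (proj₂ (⌈⌉⁻ p))
          (subst (Head _ ∘ xs) (trans (class-unique y∈P) (sym (class-unique x∈P))) (proj₂ (⌈⌉⁻ q)))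

    -- x is sent to column x of a row that depends only on the block of x and is long
    -- enough to contain that block.
    ED-Fin≤KB-restriction : (∀ n → Finite ⟪ P n ⟫) → ED-Fin ≤KB J ↾ B
    ED-Fin≤KB-restriction fin =
      g ∘ proj₁
      , injective⇒FiniteToOne (Elt-≡ ∘ cong (proj₂ ∘ proj₁))
      , λ {C} (m , rows) →
          B ∩ (C ∘ g)
          -- The column of `g x` is `x` itself, so the list for row `R n` of `C` contains all points
          -- of block `n` in `C ∘ g`, even when several blocks share a row.
          , listed∈J m (λ n → proj₁ (rows (R n))) (λ n → <⇒≤ (proj₁ (proj₂ (rows (R n)))))
              (proj₁ ∘ ∩⁻ B (C ∘ g))
              (λ {x} x∈ → proj₂ (proj₂ (rows (R (class x)))) (_ , proj₂ (∩⁻ B (C ∘ g) x∈)))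
          , λ (x , x∈B) → T-injective (∩⁺ B (C ∘ g) x∈B) (proj₂ ∘ ∩⁻ B (C ∘ g))
      where
      block : ∀ n → ∃[ b ] ∀ {x} → x ∈ ⟪ P n ⟫ → x ≤ b
      block n = let _ , xs , _ , c = fin n
                    b , p = list-bound xs
                in b , p ∘ c
      R : ℕ → ℕ
      R = proj₁ ∘ block
      g : ℕ → Δ
      g x = (R (class x) , x) , proj₂ (block (class x)) (∈-class x)

  positive-selector : ∀ {J} → IsIdeal J → KB-Homogeneous J → ¬ (ED-Fin ≤KB J) →
    ∀ {B} → B ∈ J ⁺ → ∀ {P} → IsPartition P → (∀ n → Finite ⟪ P n ⟫) →
    ∃[ S ] S ∈ J ⁺ × ⟪ S ⟫ ⊆ ⟪ B ⟫ × PartialSelector P S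
  positive-selector {J} isIdeal hom ED≰J {B} B⁺ partition fin = stable λ ¬∃ →
    ED≰J (≤KB-trans {L = J}
      (ED-Fin≤KB-restriction isIdeal partition
        (λ {S} S⊆B sel → stable λ S⁺ → ¬∃ (S , S⁺ , (λ {_} → S⊆B) , λ n {_} {_} → sel n))
        fin)
      (proj₁ (hom B B⁺)))

  -- Lower bounds of countable families.

  module _ {J : Family ℕ} (isIdeal : IsIdeal J) where

    open IsIdeal isIdeal
    open Ideal isIdeal

    -- Enumerating the indices turns a centred family into the decreasing sequence of its finite
    -- intersections, to which the P⁺ property applies.
    countable⇒HasLimits : P⁺-Ideal J → {I : Set} → I ↣ ℕ → HasLimits I
    countable⇒HasLimits P⁺ {I} e A centred =
      let B , B⁺ , B⊆ = P⁺ (λ n → ⋂ˡ A (before n)) (centred ∘ before) decreasing in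
      B , B⁺ , λ i →
        -- `before n` lists the indices with number strictly below `n`, so `i` first appears at
        -- `suc (to i)`.
        ⊆ᴶ-trans B (⋂ˡ A (before (suc (to i)))) (A i) (B⊆ (suc (to i))) (⊆⇒⊆ᴶ _ (A i) (⊆-later i))
      where
      open Injection e using (to; injective)
      extend : ∀ {n} → Dec (∃[ i ] to i ≡ n) → List I → List I
      extend (yes (i , _)) is = i ∷ is
      extend (no _)        is = is
      before : ℕ → List I
      before zero    = []
      before (suc n) = extend {n} dec (before n)
      decreasing : ∀ n → ⟪ ⋂ˡ A (before (suc n)) ⟫ ⊆ ⟪ ⋂ˡ A (before n) ⟫
      decreasing n with dec {∃[ i ] to i ≡ n}
      ... | yes (i , _) = proj₂ ∘ ∩⁻ (A i) (⋂ˡ A (before n))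
      ... | no _        = id
      ⊆-later : ∀ i → ⟪ ⋂ˡ A (before (suc (to i))) ⟫ ⊆ ⟪ A i ⟫
      ⊆-later i {x} with dec {∃[ j ] to j ≡ to i}
      ... | yes (j , e) =
        subst (λ j → x ∈ ⟪ A j ⟫) (injective e) ∘ proj₁ ∘ ∩⁻ (A j) (⋂ˡ A (before (to i)))
      ... | no ¬∃       = ⊥-elim (¬∃ (i , refl))

  -- Closed sets in the Cantor space.

  upd : 𝒫 ℕ → ℕ → Bool → 𝒫 ℕ
  upd Y n b j with j ≟ n
  ... | yes _ = b
  ... | no _  = Y j

  upd-same : ∀ Y n b → upd Y n b n ≡ b
  upd-same Y n b with n ≟ n
  ... | yes _  = refl
  ... | no n≢n = contradiction refl n≢n

  upd-below : ∀ Y n b {j} → j < n → upd Y n b j ≡ Y j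
  upd-below Y n b {j} j<n with j ≟ n
  ... | yes refl = contradiction j<n (<-irrefl refl)
  ... | no _     = refl

  -- Compactness of the Cantor space, by König's lemma.
  module _ {C : Family ℕ} (closed : IsClosed C) (D : 𝒫 ℕ) where

    CoveredBelow : ℕ → Set
    CoveredBelow k = ∃[ X ] X ∈ C × (∀ j → j < k → j ∈ ⟪ D ⟫ → j ∈ ⟪ X ⟫)

    Extendible : ℕ → 𝒫 ℕ → ℕ → Set
    Extendible n Y k =
      ∃[ X ] X ∈ C × (∀ j → j < n → X j ≡ Y j) × (∀ j → j < k → j ∈ ⟪ D ⟫ → j ∈ ⟪ X ⟫)

    -- If both values at `n` failed, at `k₀` and `k₁` say, a point of `C` that works for `k₀ ⊔ k₁`
    -- would refute the failure of the value it takes at `n`.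
    extendible-step : ∀ n Y → (∀ k → Extendible n Y k) →
                      ∃[ b ] (∀ k → Extendible (suc n) (upd Y n b) k)
    extendible-step n Y good = stable λ ¬∃ →
      let k₀ , ¬e₀ = ¬∀⇒∃¬ (λ e → ¬∃ (false , e))
          k₁ , ¬e₁ = ¬∀⇒∃¬ (λ e → ¬∃ (true , e))
          X , X∈C , X≡Y , D⊆X = good (k₀ ⊔ k₁)
          agree : ∀ j → j < suc n → X j ≡ upd Y n (X n) j
          agree j j<1+n = case m<1+n⇒m<n∨m≡n j<1+n of λ where
            (inj₁ j<n)  → trans (X≡Y j j<n) (sym (upd-below Y n (X n) j<n))
            (inj₂ refl) → sym (upd-same Y n (X n))
          below : ∀ {k} → k ≤ k₀ ⊔ k₁ → ∀ j → j < k → j ∈ ⟪ D ⟫ → j ∈ ⟪ X ⟫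
          below k≤ j j<k = D⊆X j (<-≤-trans j<k k≤)
          impossible : ∀ b → X n ≡ b → ⊥
          impossible = λ where
            false e → ¬e₀ (X , X∈C , subst (λ b → ∀ j → j < suc n → X j ≡ upd Y n b j) e agree
                             , below (m≤m⊔n k₀ k₁))
            true  e → ¬e₁ (X , X∈C , subst (λ b → ∀ j → j < suc n → X j ≡ upd Y n b j) e agree
                             , below (m≤n⊔m k₀ k₁))
      in impossible (X n) refl

    abstract
      closed-compact : (∀ k → CoveredBelow k) → ∃[ X ] X ∈ C × ⟪ D ⟫ ⊆ ⟪ X ⟫
      closed-compact h = limit , limit∈C , λ {j} j∈D →
        let X , _ , X≡ , D⊆X = proj₂ (approx (suc j)) (suc j) in
        subst T (X≡ j ≤-refl) (D⊆X j ≤-refl j∈D)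
        where
        approx : ∀ n → ∃[ Y ] ∀ k → Extendible n Y k
        approx zero    = full , λ k → let X , X∈C , D⊆X = h k in X , X∈C , (λ _ ()) , D⊆X
        approx (suc n) = let Y , good = approx n
                             b , good′ = extendible-step n Y good
                         in upd Y n b , good′
        limit : 𝒫 ℕ
        limit j = proj₁ (approx (suc j)) j
        approx≡limit : ∀ n {j} → j < n → proj₁ (approx n) j ≡ limit j
        approx≡limit (suc n) j<1+n with m<1+n⇒m<n∨m≡n j<1+n
        ... | inj₁ j<n  = trans (upd-below (proj₁ (approx n)) n _ j<n) (approx≡limit n j<n)
        ... | inj₂ refl = refl
        limit∈C : limit ∈ C
        -- A neighbourhood of `limit` outside `C` would contain a point of `C` that agrees with the
        -- approximation below `n`.
        limit∈C = stable λ limit∉C →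
          let n , outside = closed limit limit∉C
              X , X∈C , X≡ , _ = proj₂ (approx n) 0
          in outside X (λ k k<n → trans (X≡ k k<n) (approx≡limit n k<n)) X∈C

  -- Lower bounds for F-sigma ideals under 𝔭 = 𝔠.

  rows-surjective : ∀ S → ∃[ X ] rows X ≡ S
  rows-surjective S = unrows S , ext λ a → ext λ b → rows-unrows S a b

  -- König's diagonal argument in (𝒫 ℕ)^ℕ ≅ 𝒫 ℕ.
  𝒫ℕ↣I×ℕ⇒𝒫ℕ↣I : {I : Set} → 𝒫 ℕ ↣ (I × ℕ) → 𝒫 ℕ ↣ I
  𝒫ℕ↣I×ℕ⇒𝒫ℕ↣I {I} φ = case dec {∃[ n ] ∀ c → Hit n c} of λ where
      (yes (n , hit)) → mk↣ {to = λ c → proj₁ (to (proj₁ (hit c)))} λ {c} {d} e →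
        let X , X≡n , X≡c = hit c
            Y , Y≡n , Y≡d = hit d
        in trans (sym X≡c) (trans (cong (λ X → rows X n)
             (injective (cong₂ _,_ e (trans X≡n (sym Y≡n))))) Y≡d)
      (no ¬∃) →
        -- Let row `n` of `X` be a set missed at `n`, for every `n`. Then `X` itself hits the missed
        -- set at its own second coordinate.
        let missed = λ n → ¬∀⇒∃¬ (λ hit → ¬∃ (n , hit))
            X , e = rows-surjective (proj₁ ∘ missed)
            n = proj₂ (to X)
        in ⊥-elim (proj₂ (missed n) (X , refl , cong (λ S → S n) e))
    where
    open Injection φ using (to; injective)
    Hit : ℕ → 𝒫 ℕ → Set
    Hit n c = ∃[ X ] proj₂ (to X) ≡ n × rows X n ≡ c

  module _ {J : Family ℕ} (isIdeal : IsIdeal J) (Fσ : IsFσ J) where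

    open IsIdeal isIdeal
    open Ideal isIdeal

    C : ℕ → Family ℕ
    C = proj₁ Fσ

    Escapes : ℕ → 𝒫 ℕ → Set
    Escapes n s = ∀ X → X ∈ C n → ¬ ⟪ s ⟫ ⊆ ⟪ X ⟫

    -- By compactness: if every truncation of `D` were contained in a member of `C n`, then so would
    -- be `D`, and `D` would belong to `J`.
    trunc-escapes : ∀ n {D} → D ∈ J ⁺ → ∃[ k₀ ] ∀ {k} → k₀ ≤ k → Escapes n (mem (trunc D k))
    trunc-escapes n {D} D⁺ =
      let k₀ , ¬∃ = ¬∀⇒∃¬ {P = CoveredBelow (proj₁ (proj₂ Fσ) n) D} λ h →
            let X , X∈C , D⊆X = closed-compact (proj₁ (proj₂ Fσ) n) D h in
            D⁺ (⊆-closed {D} {X} D⊆X (proj₂ (proj₂ (proj₂ Fσ)) (n , X∈C)))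
      in k₀ , λ k₀≤k X X∈C s⊆X →
        ¬∃ (X , X∈C , λ j j<k₀ j∈D → s⊆X (mem-trunc⁺ D (<-≤-trans j<k₀ k₀≤k) j∈D))

    module _ {I : Set} (A : I → 𝒫 ℕ) (centred : Centred A) where

      Traces : I → ℕ → 𝒫 ℕ
      Traces i n c = ⌈ ⟪ mem (fromℕ c) ⟫ ⊆ ⟪ A i ⟫ × Escapes n (mem (fromℕ c)) ⌉

      F : 𝒫 (𝒫 ℕ)
      F Y = ⌈ ∃[ i ] ∃[ n ] Y ≡ Traces i n ⌉

      F↣I×ℕ : Elt F ↣ (I × ℕ)
      F↣I×ℕ = mk↣ {to = λ (_ , p) → let i , n , _ = ⌈⌉⁻ p in i , n} λ {(_ , p)} {(_ , q)} e →
        Elt-≡ (trans (proj₂ (proj₂ (⌈⌉⁻ p)))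
          (trans (cong (λ (i , n) → Traces i n) e) (sym (proj₂ (proj₂ (⌈⌉⁻ q))))))

      -- A truncation of `D` lies in each `A i` that contains `D`, and when it is long enough it
      -- escapes the finitely many closed sets attached to `Ys`.
      trunc∈F : ∀ Ys → All ⟪ F ⟫ Ys → ∃[ is ] ∀ {D} → D ∈ J ⁺ → ⟪ D ⟫ ⊆ ⟪ ⋂ˡ A is ⟫ →
                ∃[ k₀ ] ∀ {k} → k₀ ≤ k → All (λ Y → toℕ (trunc D k) ∈ ⟪ Y ⟫) Ys
      trunc∈F []       []       = [] , λ _ _ → 0 , λ _ → []
      trunc∈F (Y ∷ Ys) (p ∷ ps) =
        let i , n , Y≡ = ⌈⌉⁻ p
            is , rest = trunc∈F Ys ps
        in i ∷ is , λ {D} D⁺ D⊆ →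
          let k₁ , all = rest {D} D⁺ (proj₂ ∘ ∩⁻ (A i) (⋂ˡ A is) ∘ D⊆)
              k₂ , esc = trunc-escapes n D⁺
          in k₁ ⊔ k₂ , λ {k} k≥ →
            subst (λ Y → toℕ (trunc D k) ∈ ⟪ Y ⟫) (sym Y≡)
              (⌈⌉⁺ (subst (λ b → ⟪ mem b ⟫ ⊆ ⟪ A i ⟫ × Escapes n (mem b))
                (sym (fromℕ-toℕ (trunc D k)))
                ((λ {x} x∈ → proj₁ (∩⁻ (A i) (⋂ˡ A is) (D⊆ (mem-trunc⁻ D k x∈))))
                , esc (m⊔n≤o⇒n≤o k₁ k₂ k≥))))
            ∷ all (m⊔n≤o⇒m≤o k₁ k₂ k≥)

      F-SFIP : HasSFIP F
      F-SFIP Ys ps =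
        let is , tr = trunc∈F Ys ps
            D = ⋂ˡ A is
            k₀ , all = tr {D} (centred is) id
        in unbounded⇒Infinite (size ∘ fromℕ) λ n →
          -- The code of a truncation of length `k` has size `k`, so `suc n` pushes it beyond `n`
          -- and the common elements are unbounded.
          let k = k₀ ⊔ suc n in
          toℕ (trunc D k) , all (m≤m⊔n k₀ (suc n))
          , subst (n <_) (sym (trans (cong size (fromℕ-toℕ (trunc D k))) (size-trunc D k)))
              (m≤n⊔m k₀ (suc n))

      limit-from-pseudointersection : I → HasPseudointersection F →
                                      ∃[ B ] B ∈ J ⁺ × (∀ i → B ⊆ᴶ A i)
      limit-from-pseudointersection i₀ (P , P-inf , P⊆) = B , B⁺ , B⊆A
        where
        B : 𝒫 ℕ
        B x = ⌈ ∃[ c ] c ∈ ⟪ P ⟫ × x ∈ ⟪ mem (fromℕ c) ⟫ ⌉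
        P⊆Traces : ∀ i n → Finite ⟪ P ∖ Traces i n ⟫
        P⊆Traces i n = P⊆ (Traces i n) (⌈⌉⁺ (i , n , refl))
        meets : ∀ n → ∃[ c ] c ∈ ⟪ P ⟫ × c ∈ ⟪ Traces i₀ n ⟫
        meets n = stable λ ¬∃ → P-inf (Finite-⊆
          (λ {c} c∈P → ∖⁺ P (Traces i₀ n) c∈P λ c∈G → ¬∃ (c , c∈P , c∈G)) (P⊆Traces i₀ n))
        B⁺ : B ∈ J ⁺
        -- If `B` were in `C n`, it would contain no set that escapes `C n`; but `P` meets
        -- `Traces i₀ n`, and `B` contains every set coded in `P`.
        B⁺ B∈J =
          let n , B∈C = proj₁ (proj₂ (proj₂ Fσ)) B∈J
              c , c∈P , c∈G = meets n
          in proj₂ (⌈⌉⁻ c∈G) B B∈C λ x∈ → ⌈⌉⁺ (c , c∈P , x∈)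
        B⊆A : ∀ i → B ⊆ᴶ A i
        -- Only finitely many codes in `P` lie outside `Traces i 0`, and each codes a finite set;
        -- the index `0` is an arbitrary choice.
        B⊆A i = finite∈ (Finite-⊆
          (λ {x} x∈ → let x∈B , x∉A = ∖⁻ B (A i) x∈
                          c , c∈P , x∈c = ⌈⌉⁻ x∈B
                      in c , ∖⁺ P (Traces i 0) c∈P (λ c∈G → x∉A (proj₁ (⌈⌉⁻ c∈G) x∈c)) , x∈c)
          (Finite-⋃ (P⊆Traces i 0) (Finite-mem ∘ fromℕ)))

    -- If `F` had no pseudointersection, minimality of 𝔭 = 𝔠 would inject `𝒫 ℕ` into `F`, hence into
    -- `I × ℕ`, hence into `I`. For empty `I` the bound is `full`.
    Fσ⇒HasLimits : 𝔭≡𝔠 → {I : Set} → ¬ (𝒫 ℕ ↣ I) → HasLimits I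
    Fσ⇒HasLimits (_ , p-min) {I} small A centred with dec {I}
    ... | no ¬I  = full , proper , ⊥-elim ∘ ¬I
    ... | yes i₀ = limit-from-pseudointersection A centred i₀ (stable λ ¬pseudo →
      small (𝒫ℕ↣I×ℕ⇒𝒫ℕ↣I
        (F↣I×ℕ A centred ↣-∘ p-min (F A centred) (F-SFIP A centred , ¬pseudo))))

  -- Indices with small initial segments and bookkeeping.

  open WellOrder {𝒫 ℕ} full

  Small : 𝒫 ℕ → Set
  Small x = ¬ (𝒫 ℕ ↣ Elt (seg x))

  Small-≺ : ∀ {x y} → y ≺ x → Small x → Small y
  Small-≺ {x} {y} y≺x small φ = small (mk↣
    {to = λ X → proj₁ (to X) , ≺⇒seg⊆seg {y} {x} y≺x (proj₂ (to X))}
    (injective ∘ Elt-≡ ∘ cong proj₁))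
    where open Injection φ using (to; injective)

  -- Either every initial segment is small, or the least large one consists of
  -- continuum many points with small segments.
  record SmallPoints : Set where
    field
      ρ         : 𝒫 ℕ → 𝒫 ℕ
      small     : ∀ r → Small (ρ r)
      injective : ∀ {r s} → ρ r ≡ ρ s → r ≡ s

  abstract

    smallPoints : SmallPoints
    smallPoints with dec {∃[ x ] 𝒫 ℕ ↣ Elt (seg x)}
    ... | no ¬∃     = record { ρ = id ; small = λ x φ → ¬∃ (x , φ) ; injective = id }
    ... | yes large =
      let x , φ , min = least ≺-wellFounded {λ x → 𝒫 ℕ ↣ Elt (seg x)} large
          open Injection φ using (to; injective)
      in record
        { ρ         = proj₁ ∘ to
        ; small     = λ r → min (proj₁ (to r)) (proj₂ (to r))
        ; injective = injective ∘ Elt-≡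
        }

  open SmallPoints smallPoints

  -- Every sequence of sets is assigned to some small point. It serves twice: its entry 0 is a set
  -- to decide, and the whole sequence is a candidate partition. Points outside the range of `ρ` get
  -- a trivial default.
  requirement : 𝒫 ℕ → ℕ → 𝒫 ℕ
  requirement x with dec {∃[ r ] ρ r ≡ x}
  ... | yes (r , _) = rows r
  ... | no _        = λ _ → full

  requirement-ρ : ∀ r → requirement (ρ r) ≡ rows r
  requirement-ρ r with dec {∃[ s ] ρ s ≡ ρ r}
  ... | yes (s , e) = cong rows (injective e)
  ... | no ¬∃       = ⊥-elim (¬∃ (r , refl))

  requirement-surjective : ∀ P → ∃[ x ] Small x × requirement x ≡ P
  requirement-surjective P =
    let r , e = rows-surjective P in ρ r , small r , trans (requirement-ρ r) e

  -- The tower of positive sets.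

  module _ {J : Family ℕ} (isIdeal : IsIdeal J) (hom : KB-Homogeneous J)
           (ED≰J : ¬ (ED-Fin ≤KB J))
           (limits : (S : 𝒫 (𝒫 ℕ)) → ¬ (𝒫 ℕ ↣ Elt S) → Ideal.HasLimits isIdeal (Elt S)) where

    open IsIdeal isIdeal
    open Ideal isIdeal

    -- The two conditions make the tower generate an ultrafilter and a Q-point.
    Decides Meets : (ℕ → 𝒫 ℕ) → 𝒫 ℕ → Set
    Decides P B = ⟪ B ⟫ ⊆ ⟪ P 0 ⟫ ⊎ ⟪ B ⟫ ⊆ ⟪ ∁ (P 0) ⟫
    Meets P B = Decides P B × (IsPartition P → (∀ n → Finite ⟪ P n ⟫) → PartialSelector P B)

    Decides-⊆ : ∀ P {B D} → ⟪ B ⟫ ⊆ ⟪ D ⟫ → Decides P D → Decides P B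
    Decides-⊆ P B⊆D (inj₁ p) = inj₁ (p ∘ B⊆D)
    Decides-⊆ P B⊆D (inj₂ p) = inj₂ (p ∘ B⊆D)

    positive-decides : ∀ P {B} → B ∈ J ⁺ → ∃[ D ] D ∈ J ⁺ × ⟪ D ⟫ ⊆ ⟪ B ⟫ × Decides P D
    positive-decides P {B} B⁺ with dec {B ∩ P 0 ∈ J}
    ... | no ∩⁺′ = B ∩ P 0 , ∩⁺′ , proj₁ ∘ ∩⁻ B (P 0) , inj₁ (proj₂ ∘ ∩⁻ B (P 0))
    ... | yes ∩∈J =
      B ∩ ∁ (P 0)
      , (λ ∖∈J → B⁺ (∈J-cover ∩∈J ∖∈J λ {x} x∈B → case T? (P 0 x) of λ where
          (yes p) → inj₁ (∩⁺ B (P 0) x∈B p)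
          (no ¬p) → inj₂ (∖⁺ B (P 0) x∈B ¬p)))
      , proj₁ ∘ ∩⁻ B (∁ (P 0)) , inj₂ (proj₂ ∘ ∩⁻ B (∁ (P 0)))

    positive-meets : ∀ P {B} → B ∈ J ⁺ → ∃[ D ] D ∈ J ⁺ × ⟪ D ⟫ ⊆ ⟪ B ⟫ × Meets P D
    positive-meets P B⁺ with positive-decides P B⁺ | dec {IsPartition P × (∀ n → Finite ⟪ P n ⟫)}
    ... | D , D⁺ , D⊆B , decides | no ¬fin =
      D , D⁺ , D⊆B , decides , λ part fin → ⊥-elim (¬fin (part , fin))
    ... | D , D⁺ , D⊆B , decides | yes (part , fin)
      with positive-selector isIdeal hom ED≰J D⁺ part fin
    ...   | S , S⁺ , S⊆D , sel =
      S , S⁺ , D⊆B ∘ S⊆D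
      , Decides-⊆ P {S} {D} S⊆D decides , λ _ _ → sel

    Good : ∀ x → (∀ {y} → y ≺ x → 𝒫 ℕ) → 𝒫 ℕ → Set
    Good x A B = B ∈ J ⁺ × (∀ {y} (y≺x : y ≺ x) → B ⊆ᴶ A y≺x) × Meets (requirement x) B

    -- The recursion needs a value before good sets are known to exist, hence the default `full`;
    -- `tower-Good` shows that good sets exist at small points.
    choose : ∀ x → (∀ {y} → y ≺ x → 𝒫 ℕ) → 𝒫 ℕ
    choose x A with dec {∃ (Good x A)}
    ... | yes (B , _) = B
    ... | no _        = full

    choose-Good : ∀ x (A : ∀ {y} → y ≺ x → 𝒫 ℕ) → ∃ (Good x A) → Good x A (choose x A)
    choose-Good x A ∃B with dec {∃ (Good x A)}
    ... | yes (_ , good) = good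
    ... | no ¬∃          = ⊥-elim (¬∃ ∃B)

    abstract

      tower : 𝒫 ℕ → 𝒫 ℕ
      tower = All.wfRec ≺-wellFounded 0ℓ (λ _ → 𝒫 ℕ) choose

      tower-unfold : ∀ x → tower x ≡ choose x (λ {y} _ → tower y)
      tower-unfold x = FixPoint.unfold-wfRec ≺-wellFounded (λ _ → 𝒫 ℕ) choose choose-ext
        where
        choose-ext : ∀ x {A A′ : ∀ {y} → y ≺ x → 𝒫 ℕ} →
                     (∀ {y} (y≺x : y ≺ x) → A y≺x ≡ A′ y≺x) → choose x A ≡ choose x A′
        choose-ext x e =
          -- The implicit argument is made explicit so that `ext` applies.
          cong (λ (A : ∀ y → y ≺ x → 𝒫 ℕ) → choose x (λ {y} → A y)) (ext λ y → ext e)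

    TowerGood : 𝒫 ℕ → Set
    TowerGood x = Good x (λ {y} _ → tower y) (tower x)

    -- The later point serves. Recording that it is `x` or `y` lets smallness and membership in a
    -- segment carry over to it.
    directed : ∀ x y → TowerGood x → TowerGood y →
               ∃[ z ] (z ≡ x ⊎ z ≡ y) × tower z ⊆ᴶ tower x × tower z ⊆ᴶ tower y
    directed x y (_ , gx , _) (_ , gy , _) with ≺-cmp x y
    ... | inj₁ x≺y         = y , inj₂ refl , gy x≺y , ⊆ᴶ-refl (tower y)
    ... | inj₂ (inj₁ refl) = x , inj₁ refl , ⊆ᴶ-refl (tower x) , ⊆ᴶ-refl (tower x)
    ... | inj₂ (inj₂ y≺x)  = x , inj₁ refl , ⊆ᴶ-refl (tower x) , gx y≺x

    module _ (S : 𝒫 (𝒫 ℕ)) (good : ∀ {x} → x ∈ ⟪ S ⟫ → TowerGood x) where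

      -- The tower is a chain modulo `J`, so one of finitely many members is below all the others.
      -- The list is non-empty in order to supply such a member.
      below-⋂ : ∀ (i : Elt S) is → ∃[ j ] tower (proj₁ {B = ⟪ S ⟫} j) ⊆ᴶ ⋂ˡ (tower ∘ proj₁) (i ∷ is)
      below-⋂ i [] = i , ⊆ᴶ-∩ (tower (proj₁ i)) (tower (proj₁ i)) full
        (⊆ᴶ-refl (tower (proj₁ i))) (⊆⇒⊆ᴶ (tower (proj₁ i)) full _)
      below-⋂ i@(x , x∈S) (k ∷ is) =
        let (y , y∈S) , p = below-⋂ k is
            z , z≡ , zx , zy = directed x y (good x∈S) (good y∈S)
        in (z , [ (λ e → subst (⟪ S ⟫) (sym e) x∈S) , (λ e → subst (⟪ S ⟫) (sym e) y∈S) ]′ z≡)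
           , ⊆ᴶ-∩ (tower z) (tower x) (⋂ˡ (tower ∘ proj₁) (k ∷ is)) zx
               (⊆ᴶ-trans (tower z) (tower y) (⋂ˡ (tower ∘ proj₁) (k ∷ is)) zy p)

      tower-centred : Centred {Elt S} (tower ∘ proj₁)
      tower-centred []       = proper
      tower-centred (i ∷ is) =
        let (y , y∈S) , p = below-⋂ i is in
        J⁺-⊆ᴶ (tower y) (⋂ˡ (tower ∘ proj₁) (i ∷ is)) p (proj₁ (good y∈S))

    -- Successor and limit stages are treated alike: the earlier sets are centred, `limits` gives a
    -- positive lower bound, and this is shrunk to meet the requirement at `x`.
    tower-Good : ∀ x → Small x → TowerGood x
    tower-Good = All.wfRec ≺-wellFounded 0ℓ (λ x → Small x → TowerGood x) λ x ih small →
      let B , B⁺ , B⊆ = limits (seg x) small (tower ∘ proj₁)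
            (tower-centred (seg x) λ {y} y≺x → ih y≺x (Small-≺ {x} y≺x small))
          D , D⁺ , D⊆B , meets = positive-meets (requirement x) B⁺
      in subst (Good x (λ {y} _ → tower y)) (sym (tower-unfold x))
           (choose-Good x _
             (D , D⁺ , (λ {y} y≺x → ⊆ᴶ-trans D B (tower y) (⊆⇒⊆ᴶ D B D⊆B) (B⊆ (y , y≺x))) , meets))

    -- The Q-point generated by the tower.

    U : Family ℕ
    U S = ∃[ x ] Small x × tower x ⊆ᴶ S

    Meets∈U : ∀ P → ∃[ x ] tower x ∈ U × Meets P (tower x)
    Meets∈U P =
      let x , small , e = requirement-surjective P
          _ , _ , meets = tower-Good x small
      in x , (x , small , ⊆ᴶ-refl (tower x)) , subst (λ P → Meets P (tower x)) e meets

    U-upward : ∀ {A B} → ⟪ A ⟫ ⊆ ⟪ B ⟫ → A ∈ U → B ∈ U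
    U-upward {A} {B} A⊆B (x , small , p) =
      x , small , ⊆ᴶ-trans (tower x) A B p (⊆⇒⊆ᴶ A B A⊆B)

    J-complement∈U : ∀ {B} → B ∈ J → ∁ B ∈ U
    J-complement∈U {B} B∈J =
      -- The constant sequence only provides some small point: what any tower set has outside `∁ B`
      -- lies in `B`.
      let x , small , _ = requirement-surjective (λ _ → full) in
      x , small , IsIdeal.⊆-closed isIdeal
        (λ {y} p → let _ , q = ∖⁻ (tower x) (∁ B) p in
                   case T? (B y) of λ where
                     (yes b) → b
                     (no ¬b) → ⊥-elim (q (¬T⇒T-not (B y) ¬b))) B∈J

    U-isUltrafilter : IsUltrafilter U
    U-isUltrafilter = record
      { ⊆-closed  = U-upward
      ; ∩-closed  = λ {A} {B} (x , x-small , p) (y , y-small , q) →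
          let z , z≡ , zx , zy = directed x y (tower-Good x x-small) (tower-Good y y-small) in
          z , [ (λ e → subst Small (sym e) x-small) , (λ e → subst Small (sym e) y-small) ]′ z≡
          , ⊆ᴶ-∩ (tower z) A B (⊆ᴶ-trans (tower z) (tower x) A zx p)
                               (⊆ᴶ-trans (tower z) (tower y) B zy q)
      ; proper    = λ {A} (x , small , p) → stable λ ¬∃ →
          J⁺-⊆ᴶ (tower x) A p (proj₁ (tower-Good x small)) (∅∈J λ y∈A → ¬∃ (_ , y∈A))
      ; ultra     = λ A →
          let x , x∈U , decides , _ = Meets∈U (λ _ → A) in
          case decides of λ where
            (inj₁ p) → inj₁ (U-upward {tower x} {A} p x∈U)
            (inj₂ p) → inj₂ (U-upward {tower x} {∁ A} p x∈U)
      ; cofinite∈ = λ {A} fin →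
          U-upward {∁ (∁ A)} {A}
            (λ {x} p → stable λ x∉A → T-not⇒¬T (∁ A x) p (¬T⇒T-not (A x) x∉A))
            (J-complement∈U (finite∈ fin))
      }

    -- A tower set meets each block at most once. Adding a point from every block that it misses
    -- gives a full selector, which is in `U` as a superset.
    U-selector : ∀ P → IsPartition P → (∀ n → Finite ⟪ P n ⟫) →
                 ∃[ S ] S ∈ U × (∀ n → ∃! _≡_ (λ x → x ∈ ⟪ S ∩ P n ⟫))
    U-selector P part fin = S , S∈U , one
      where
      open IsPartition part
      B : 𝒫 ℕ
      B = tower (proj₁ (Meets∈U P))
      B-selector : PartialSelector P B
      B-selector = proj₂ (proj₂ (proj₂ (Meets∈U P))) part fin
      cls : ℕ → ℕ
      cls x = proj₁ (covers x)
      select : ∀ n → ∃[ x ] x ∈ ⟪ P n ⟫ × (∀ {y} → y ∈ ⟪ B ⟫ → y ∈ ⟪ P n ⟫ → x ≡ y)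
      select n with dec {∃[ x ] x ∈ ⟪ B ⟫ × x ∈ ⟪ P n ⟫}
      ... | yes (x , x∈B , x∈P) = x , x∈P , λ y∈B y∈P → B-selector n x∈B y∈B x∈P y∈P
      ... | no ¬∃ =
        proj₁ (nonempty n) , proj₂ (nonempty n) , λ y∈B y∈P → ⊥-elim (¬∃ (_ , y∈B , y∈P))
      S : 𝒫 ℕ
      S x = ⌈ proj₁ (select (cls x)) ≡ x ⌉
      S∈U : S ∈ U
      S∈U = U-upward
        (λ {x} x∈B → ⌈⌉⁺ (proj₂ (proj₂ (select (cls x))) x∈B (proj₁ (proj₂ (covers x)))))
        (proj₁ (proj₂ (Meets∈U P)))
      one : ∀ n → ∃! _≡_ (λ x → x ∈ ⟪ S ∩ P n ⟫)
      one n =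
        let x , x∈P , _ = select n in
        x , ∩⁺ S (P n) (⌈⌉⁺ (cong (proj₁ ∘ select) (proj₂ (proj₂ (covers x)) x∈P))) x∈P
        , λ {y} p → let y∈S , y∈P = ∩⁻ S (P n) p in
            trans (sym (cong (proj₁ ∘ select) (proj₂ (proj₂ (covers y)) y∈P))) (⌈⌉⁻ y∈S)

    QPoint-extending-J* : ∃[ U ] IsQPoint U × J ≤P U *
    QPoint-extending-J* =
      U , record { isUltrafilter = U-isUltrafilter ; selector = U-selector }
      , id , id , λ {B} B∈J → ∁ B , J-complement∈U B∈J , λ x → sym (not-involutive (B x))

  -- The equivalences.

  ≤P⇒≤KB : {X Y : Set} {I : Family X} {K : Family Y} → I ≤P K → I ≤KB K
  ≤P⇒≤KB (f , inj , pres) = f , injective⇒FiniteToOne inj , pres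

  equivalences : ∀ {J} (isIdeal : IsIdeal J) → KB-Homogeneous J →
    ((S : 𝒫 (𝒫 ℕ)) → ¬ (𝒫 ℕ ↣ Elt S) → Ideal.HasLimits isIdeal (Elt S)) →
    TFAE₃ (¬ (ED-Fin ≤KB J))
          (∃[ U ] IsQPoint U × ¬ IsPoint J U)
          (∃[ U ] IsQPoint U × ¬ IsWeakUltrafilter J U)
  equivalences {J} isIdeal hom limits = mk⇔ a⇒b (c⇒a ∘ b⇒c) , mk⇔ b⇒c (a⇒b ∘ c⇒a)
    where
    a⇒b : ¬ (ED-Fin ≤KB J) → ∃[ U ] IsQPoint U × ¬ IsPoint J U
    a⇒b ED≰J = let U , q , J≤P = QPoint-extending-J* isIdeal hom ED≰J limits in
      U , q , λ point → point J≤P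
    b⇒c : ∃[ U ] IsQPoint U × ¬ IsPoint J U → ∃[ U ] IsQPoint U × ¬ IsWeakUltrafilter J U
    b⇒c (U , q , ¬point) = U , q , λ weak → ¬point (weak ∘ ≤P⇒≤KB {K = U *})
    c⇒a : ∃[ U ] IsQPoint U × ¬ IsWeakUltrafilter J U → ¬ (ED-Fin ≤KB J)
    -- Composing `ED-Fin ≤KB J` with `J ≤KB U *` would reduce `ED-Fin` to the dual ideal of a
    -- Q-point.
    c⇒a (U , q , ¬weak) ED≤J = ¬weak λ J≤U → QPoint⇒ED-Fin≰KB q (≤KB-trans {L = U *} ED≤J J≤U)

theorem8p5 :
    (∀ ℓ → ExcludedMiddle ℓ) →
    (∀ a b → Extensionality a b) →
    (J : Family ℕ) → IsIdeal J → P⁺-Ideal J → KB-Homogeneous J →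
    (CH →
      TFAE₃ (¬ (ED-Fin ≤KB J))
            (∃[ U ] IsQPoint U × ¬ IsPoint J U)
            (∃[ U ] IsQPoint U × ¬ IsWeakUltrafilter J U))
    ×
    (IsFσ J → 𝔭≡𝔠 →
      TFAE₃ (¬ (ED-Fin ≤KB J))
            (∃[ U ] IsQPoint U × ¬ IsPoint J U)
            (∃[ U ] IsQPoint U × ¬ IsWeakUltrafilter J U))
theorem8p5 em ext J isIdeal P⁺ hom =
  -- Under CH a set into which `𝒫 ℕ` does not inject is countable.
  (λ ch → equivalences isIdeal hom λ S small →
    countable⇒HasLimits isIdeal P⁺ ([ id , ⊥-elim ∘ small ]′ (ch S)))
  , λ Fσ 𝔭≡𝔠 → equivalences isIdeal hom λ S → Fσ⇒HasLimits isIdeal Fσ 𝔭≡𝔠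
  where open Classical (em 0ℓ) (ext 0ℓ 0ℓ)
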